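{- Suppose that $\mathbf h=(h_1,h_2,h_4)\in\mathbb Z^3\setminus\{\mathbf 0\}$ and $\varepsilon>0$. Then $T_3(P;\mathbf h)\ll P^{2+\varepsilon}$ for positive integers $P$, where the implied constant depends only on $\varepsilon$.
   Context: For a positive integer $P$ and an integer triple $\mathbf h=(h_1,h_2,h_4)\in\mathbb Z^3$ (indexed by $1,2,4$), $T_3(P;\mathbf h)$ denotes the number of integer tuples $(x_1,x_2,x_3,y_1,y_2,y_3)$ with $1\le x_i,y_i\le P$ $(1\le i\le 3)$ satisfying $$\sum_{i=1}^3(x_i^j-y_i^j)=h_j\quad (j=1,2,4).$$ -}

module Defs where

open import Data.Integer.Base as ℤ using (ℤ; +_)
import Data.Integer.Properties as ℤ
open import Data.List.Base using (List; []; _∷_; length; map; upTo; filter; cartesianProduct; cartesianProductWith)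
open import Data.Nat.Base using (ℕ; zero; suc; _+_; _*_; _^_; _≤_; NonZero)
open import Data.Product.Base using (_×_; _,_; ∃-syntax)
open import Data.Rational.Base as ℚ using (ℚ; 0ℚ; _/_)
open import Data.Sum.Base using (_⊎_)
open import Data.Vec.Base as Vec using (Vec; []; _∷_; zipWith; foldr′)
open import Function.Bundles using (_⇔_)
open import Relation.Binary.PropositionalEquality using (_≡_)
open import Relation.Nullary.Decidable using (Dec; _×-dec_)
open import Relation.Nullary.Negation using (¬_)

-- Two-sided Dedekind cuts: lower q means q < x, upper q means x < q.
record ℝ : Set₁ where
  field
    lower         : ℚ → Set
    upper         : ℚ → Set
    lower-inhab   : ∃[ q ] lower q
    upper-inhab   : ∃[ q ] upper q
    lower-rounded : ∀ q → lower q ⇔ (∃[ r ] (q ℚ.< r × lower r))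
    upper-rounded : ∀ q → upper q ⇔ (∃[ r ] (r ℚ.< q × upper r))
    disjoint      : ∀ q → ¬ (lower q × upper q)
    located       : ∀ {q r} → q ℚ.< r → lower q ⊎ upper r

open ℝ public

Positive : ℝ → Set
Positive x = lower x 0ℚ

-- N ≤ C · P^(k + ε), for P ≥ 1 and real ε ≥ 0. Here P^(k + ε) is the infimum
-- of P^(k + a/b) over the rationals a/b > ε, and N ≤ C · P^(k + a/b) is
-- stated after raising both sides to the power b.
infix 4 _≤_·_^⟨_+_⟩

_≤_·_^⟨_+_⟩ : ℕ → ℕ → ℕ → ℕ → ℝ → Set
N ≤ C · P ^⟨ k + ε ⟩ =
  ∀ a b .{{_ : NonZero b}} → upper ε (+ a / b) → N ^ b ≤ C ^ b * P ^ (k * b + a)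

interval : ℕ → List ℤ
interval P = map (λ i → + suc i) (upTo P)

vectors : ∀ {A : Set} n → List A → List (Vec A n)
vectors zero    as = [] ∷ []
vectors (suc n) as = cartesianProductWith _∷_ as (vectors n as)

powerDiff : ∀ {n} → ℕ → Vec ℤ n → Vec ℤ n → ℤ
powerDiff j x y = foldr′ ℤ._+_ ℤ.0ℤ (zipWith (λ xᵢ yᵢ → xᵢ ℤ.^ j ℤ.- yᵢ ℤ.^ j) x y)

Solution : ℤ × ℤ × ℤ → Vec ℤ 3 × Vec ℤ 3 → Set
Solution (h₁ , h₂ , h₄) (x , y) =
  powerDiff 1 x y ≡ h₁ × powerDiff 2 x y ≡ h₂ × powerDiff 4 x y ≡ h₄

solution? : ∀ h xy → Dec (Solution h xy)
solution? (h₁ , h₂ , h₄) (x , y) =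
  (powerDiff 1 x y ℤ.≟ h₁) ×-dec (powerDiff 2 x y ℤ.≟ h₂) ×-dec (powerDiff 4 x y ℤ.≟ h₄)

T₃ : ℕ → ℤ × ℤ × ℤ → ℕ
T₃ P h = length (filter (solution? h) (cartesianProduct box box))
  where
  box : List (Vec ℤ 3)
  box = vectors 3 (interval P)

{-# OPTIONS --safe #-}

-- Fix (x₁ , y₁), put kⱼ = hⱼ - (x₁ʲ - y₁ʲ), and write u = x₂ + x₃ and m = x₂² + x₃². As
-- 2 (x₂⁴ + x₃⁴) = m² + 2 u² m - u⁴ and y₂ + y₃ = u - k₁, y₂² + y₃² = m - k₂, the quartic
-- equation defines a curve in (u , m) on which ℓ · m is a polynomial in u for the linear
-- form ℓ = (2 u - k₁) k₁ + k₂, and ℓ divides Δ = 4 k₁² k₄ - 2 k₂³ - 2 k₁⁴ k₂.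
-- If k₁ Δ ≠ 0, the divisor bound leaves P^ε possibilities for each of the P² pairs (x₁ , y₁).
-- Otherwise (x₁ , y₁) is one of O(P) pairs: Δ is a cubic in x₁ + y₁ for given x₁ - y₁, and
-- its coefficients do not all vanish as h ≠ 0. For such a pair there are O(P) completions,
-- unless ℓ = k₁ = 0; then h₁ ≠ 0, so (x₁ , y₁) is unique and has O(P²) completions.

module Submission where

open import Defs
open import Data.Integer.Base as ℤ using (ℤ; +_; -[1+_]; 0ℤ)
import Data.Integer.Properties as ℤ
open import Data.List.Base using (List; []; _∷_; cartesianProduct; deduplicate; filter; length; map)
open import Data.List.Membership.Propositional using (_∈_)
open import Data.List.Membership.Propositional.Properties
  using (∈-map⁺; ∈-map⁻; ∈-deduplicate⁺; ∈-filter⁻; ∈-upTo⁻; ∈-cartesianProduct⁻;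
         ∈-cartesianProductWith⁻)
open import Data.List.Properties using (length-map)
open import Data.List.Relation.Unary.All as All using (All; []; _∷_)
import Data.List.Relation.Unary.All.Properties as All
open import Data.List.Relation.Unary.AllPairs using ([]; _∷_)
open import Data.List.Relation.Unary.Any using (here; there)
open import Data.List.Relation.Unary.Unique.DecPropositional.Properties using (deduplicate-!)
open import Data.List.Relation.Unary.Unique.Propositional using (Unique)
import Data.List.Relation.Unary.Unique.Propositional.Properties as Unique
open import Data.Nat.Base as ℕ using (ℕ; zero; suc; _≤_; _<_; s≤s; z≤n; NonZero)
import Data.Nat.Properties as ℕ
open import Data.Product.Base using (_×_; _,_; ∃-syntax; proj₁; proj₂)
open import Data.Product.Properties using (≡-dec)
open import Data.Rational.Base as ℚ using (mkℚ; 0ℚ)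
import Data.Rational.Properties as ℚ
import Data.Rational.Unnormalised.Base as ℚᵘ
import Data.Rational.Unnormalised.Properties as ℚᵘ
open import Data.Sum.Base using (_⊎_; inj₁; inj₂)
open import Data.Vec.Base using (Vec; []; _∷_)
open import Data.Vec.Properties using (∷-injective)
import Data.Vec.Relation.Unary.All as Vec
open import Function.Base using (_∘_; id)
open import Function.Bundles using (Equivalence)
open import Relation.Binary.Definitions using (DecidableEquality; tri<; tri≈; tri>)
open import Relation.Binary.PropositionalEquality
open import Relation.Nullary.Decidable using (yes; no)
open import Relation.Nullary.Negation using (¬_; contradiction)

-- Cardinality bounds for predicates.

module Counting where
  open import Data.Nat.Base using (_+_; _*_)
  open import Data.Nat.Properties

  private variable
    A B : Set
    P Q : A → Set
    m n : ℕ

  -- Quantifying over duplicate-free lists allows undecidable predicates on infinite types; `T₃`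
  -- enters as the length of one such list.
  AtMost : ℕ → (A → Set) → Set
  AtMost n P = ∀ xs → Unique xs → All P xs → length xs ≤ n

  relax : m ≤ n → AtMost m P → AtMost n P
  relax m≤n c xs xs! Pxs = ≤-trans (c xs xs! Pxs) m≤n

  weaken : (∀ {a} → P a → Q a) → AtMost n Q → AtMost n P
  weaken P⊆Q c xs xs! Pxs = c xs xs! (All.map P⊆Q Pxs)

  -- The empty list satisfies every bound, so a bound may be proved with a reference element of `P`
  -- at hand.
  inhabited : (∀ {a} → P a → AtMost n P) → AtMost n P
  inhabited c []       _   _            = z≤n
  inhabited c (x ∷ xs) xs! Pxs@(Px ∷ _) = c Px (x ∷ xs) xs! Pxs

  empty : (∀ {a} → ¬ P a) → AtMost 0 P
  empty ¬P = inhabited (λ Pa → contradiction Pa ¬P)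

  injection : (f : A → B) → (∀ {a} → P a → Q (f a)) →
              (∀ {a a′} → P a → P a′ → f a ≡ f a′ → a ≡ a′) →
              AtMost n Q → AtMost n P
  injection {P = P} {Q = Q} f P⇒Q inj c xs xs! Pxs =
    subst (_≤ _) (length-map f xs) (c (map f xs) (fxs! xs! Pxs) (All.map⁺ (All.map P⇒Q Pxs)))
    where
    fresh : ∀ {x xs} → P x → All (x ≢_) xs → All P xs → All (λ y → f x ≢ f y) xs
    fresh Px []         []         = []
    fresh Px (x≢y ∷ ≢s) (Py ∷ Pys) = (x≢y ∘ inj Px Py) ∷ fresh Px ≢s Pys
    fxs! : ∀ {xs} → Unique xs → All P xs → Unique (map f xs)
    fxs! []          []         = []
    fxs! (x∉xs ∷ xs!) (Px ∷ Pxs) = All.map⁺ (fresh Px x∉xs Pxs) ∷ fxs! xs! Pxs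

  subsingleton : (∀ {a a′ : A} → P a → P a′ → a ≡ a′) → AtMost 1 P
  subsingleton c []           _                  _             = z≤n
  subsingleton c (x ∷ [])     _                  _             = s≤s z≤n
  subsingleton c (x ∷ y ∷ xs) ((x≢y ∷ _) ∷ _) (Px ∷ Py ∷ _) = contradiction (c Px Py) x≢y

  singleton : (a : A) → AtMost 1 (_≡ a)
  singleton a = subsingleton (λ x≡a y≡a → trans x≡a (sym y≡a))

  -- Made for counting roots: the roots other than a given one belong to a polynomial of lower
  -- degree.
  remove : (∀ {a} → P a → AtMost n (λ b → P b × b ≢ a)) → AtMost (suc n) P
  remove c []       _            _          = z≤n
  remove c (x ∷ xs) (x∉xs ∷ xs!) (Px ∷ Pxs) =
    s≤s (c Px xs xs! (All.zip (Pxs , All.map (_∘ sym) x∉xs)))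

  union : AtMost m P → AtMost n Q → AtMost (m + n) (λ a → P a ⊎ Q a)
  union {P = P} {Q = Q} c d xs xs! PQxs =
    let ys , zs , ys! , zs! , Pys , Qzs , _ , _ , eq = split xs xs! PQxs in
    subst (_≤ _) eq (+-mono-≤ (c ys ys! Pys) (d zs zs! Qzs))
    where
    -- The two clauses on `R` hand any property of the whole list down to both parts; they keep a
    -- new head distinct from the later entries.
    split : ∀ xs → Unique xs → All (λ a → P a ⊎ Q a) xs → ∃[ ys ] ∃[ zs ]
            (Unique ys × Unique zs × All P ys × All Q zs ×
             (∀ {R : _ → Set} → All R xs → All R ys) × (∀ {R : _ → Set} → All R xs → All R zs) ×
             length ys + length zs ≡ length xs)
    split [] [] [] = [] , [] , [] , [] , [] , [] , id , id , refl
    split (x ∷ xs) (x∉xs ∷ xs!) (px ∷ pxs) with split xs xs! pxs | px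
    ... | ys , zs , ys! , zs! , Pys , Qzs , f , g , eq | inj₁ Px =
      x ∷ ys , zs , f x∉xs ∷ ys! , zs! , Px ∷ Pys , Qzs ,
      (λ { (r ∷ rs) → r ∷ f rs }) , (λ { (r ∷ rs) → g rs }) , cong suc eq
    ... | ys , zs , ys! , zs! , Pys , Qzs , f , g , eq | inj₂ Qx =
      ys , x ∷ zs , ys! , g x∉xs ∷ zs! , Pys , Qx ∷ Qzs ,
      (λ { (r ∷ rs) → f rs }) , (λ { (r ∷ rs) → r ∷ g rs }) ,
      trans (+-suc (length ys) (length zs)) (cong suc eq)

  -- The distinct values of `f` on the list satisfy `Q`, so there are at most `m` of them, and over
  -- each lie at most `n` entries.
  fibre : DecidableEquality B → (f : A → B) → (∀ {a} → P a → Q (f a)) → AtMost m Q →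
          (∀ b → AtMost n (λ a → P a × f a ≡ b)) → AtMost (m * n) P
  fibre {A = A} {P = P} {n = n} _≟_ f P⇒Q c d xs xs! Pxs =
    ≤-trans (cover ys xs xs! Pxs (λ x∈ → ∈-deduplicate⁺ _≟_ (∈-map⁺ f x∈)))
            (*-monoˡ-≤ n (c ys (deduplicate-! _≟_ (map f xs))
              (All.deduplicate⁺ _≟_ (All.map⁺ (All.map P⇒Q Pxs)))))
    where
    ys = deduplicate _≟_ (map f xs)
    cover : ∀ ys (xs : List A) → Unique xs → All P xs → (∀ {x} → x ∈ xs → f x ∈ ys) →
            length xs ≤ length ys * n
    cover [] []       _ _ _ = z≤n
    cover [] (x ∷ xs) _ _ h with h (here refl)
    ... | ()
    cover (y ∷ ys) xs xs! Pxs h =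
      weaken split (union (d y) (λ zs zs! Pzs → cover ys zs zs! (All.map proj₁ Pzs) (lookup Pzs)))
        xs xs! (All.zip (Pxs , All.tabulate h))
      where
      lookup : ∀ {zs} → All (λ a → P a × f a ∈ ys) zs → ∀ {x} → x ∈ zs → f x ∈ ys
      lookup Pzs x∈ = proj₂ (All.lookup Pzs x∈)
      split : ∀ {a} → P a × f a ∈ y ∷ ys → (P a × f a ≡ y) ⊎ (P a × f a ∈ ys)
      split (Pa , here eq)  = inj₁ (Pa , eq)
      split (Pa , there e∈) = inj₂ (Pa , e∈)

  pair : DecidableEquality A → AtMost m P → AtMost n Q →
         AtMost (m * n) (λ ((a , b) : A × B) → P a × Q b)
  pair _≟_ c d = fibre _≟_ proj₁ proj₁ c
    (λ _ → injection proj₂ (proj₂ ∘ proj₁) (λ { (_ , refl) (_ , refl) refl → refl }) d)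

-- The divisor bound.

module Divisors where
  open Counting
  open import Data.Nat.Base
  open import Data.Nat.Coprimality using (Coprime; coprime-divisor)
  open import Data.Nat.Divisibility
  open import Data.Nat.DivMod using (_/_; _%_; m≡m%n+[m/n]*n; m%n<n; m/n*n≤m; m*n/n≡m)
  open import Data.Nat.Induction using (<-rec)
  open import Data.Nat.ListAction using (product)
  open import Data.Nat.Primality
  open import Data.Nat.Primality.Factorisation using (factorise)
  open import Data.Nat.Properties

  private variable
    m n p q r D : ℕ

  ^-distribʳ-* : ∀ q m n → (m * n) ^ q ≡ m ^ q * n ^ q
  ^-distribʳ-* zero    m n = refl
  ^-distribʳ-* (suc q) m n =
    trans (cong (m * n *_) (^-distribʳ-* q m n)) ([m*n]*[o*p]≡[m*o]*[n*p] m n (m ^ q) (n ^ q))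

  prime∤⇒coprime : ∀ {e} → Prime p → p ∤ e → Coprime e p
  prime∤⇒coprime pp p∤e (d∣e , d∣p) with prime⇒irreducible pp d∣p
  ... | inj₁ d≡1  = d≡1
  ... | inj₂ refl = contradiction d∣e p∤e

  -- A divisor of `p * n` is either prime to `p`, hence a divisor of `m`, or `p` times a divisor of
  -- `n`.
  divisors-p*n : Prime p → AtMost D (_∣ m) → AtMost r (_∣ n) →
                 (∀ {e} → e ∣ p * n → p ∤ e → e ∣ m) → AtMost (D + r) (_∣ p * n)
  divisors-p*n {p} {m = m} {n = n} pp c d coprimePart = weaken split (union c multiples)
    where
    instance _ = prime⇒nonZero pp
    multiples : AtMost _ (λ e → p ∣ e × e ∣ p * n)
    multiples = injection (λ e → e / p)
      (λ { (divides-refl k , e∣pn) → subst (_∣ n) (sym (m*n/n≡m k p))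
             (*-cancelˡ-∣ p (subst (_∣ p * n) (*-comm k p) e∣pn)) })
      (λ { (divides-refl k , _) (divides-refl l , _) eq →
             cong (_* p) (trans (sym (m*n/n≡m k p)) (trans eq (m*n/n≡m l p))) }) d
    split : ∀ {e} → e ∣ p * n → e ∣ m ⊎ (p ∣ e × e ∣ p * n)
    split {e} e∣pn with p ∣? e
    ... | yes p∣e = inj₂ (p∣e , e∣pn)
    ... | no  p∤e = inj₁ (coprimePart e∣pn p∤e)

  -- Each further factor `p` adds at most `D` divisors, because a divisor prime to `p` divides `m`
  -- by Euclid's lemma.
  divisors-p^a*m : ∀ {D m p} a → Prime p → AtMost D (_∣ m) → AtMost (suc a * D) (_∣ p ^ a * m)
  divisors-p^a*m {D} {m} zero pp c =
    subst (λ k → AtMost (D + 0) (_∣ k)) (sym (+-identityʳ m)) (relax (m≤m+n D 0) c)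
  divisors-p^a*m {D} {m} {p} (suc a) pp c =
    subst (λ k → AtMost (suc (suc a) * D) (_∣ k)) (sym (*-assoc p (p ^ a) m))
      (divisors-p*n pp c (divisors-p^a*m a pp c)
        (λ {e} e∣ p∤e → strip (suc a) (subst (e ∣_) (sym (*-assoc p (p ^ a) m)) e∣) p∤e))
    where
    strip : ∀ a {e} → e ∣ p ^ a * m → p ∤ e → e ∣ m
    strip zero    {e} e∣ _   = subst (e ∣_) (+-identityʳ m) e∣
    strip (suc a) {e} e∣ p∤e = strip a (coprime-divisor (prime∤⇒coprime pp p∤e)
      (subst (e ∣_) (*-assoc p (p ^ a) m) e∣)) p∤e

  n<2^n : ∀ n → n < 2 ^ n
  n<2^n zero    = s≤s z≤n
  n<2^n (suc n) = ≤-trans (s≤s (n<2^n n)) (≤-trans (+-monoˡ-≤ (2 ^ n) (m^n>0 2 n))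
    (≤-reflexive (cong (λ k → 2 ^ n + k) (sym (+-identityʳ (2 ^ n))))))

  -- Dividing a by q gives a + 1 ≤ q (a / q + 1) ≤ q 2^(a / q).
  poly≤exp : ∀ q .{{_ : NonZero q}} a → suc a ^ q ≤ q ^ q * 2 ^ a
  poly≤exp q a = begin
    suc a ^ q                    ≤⟨ ^-monoˡ-≤ q step ⟩
    (q * 2 ^ (a / q)) ^ q        ≡⟨ ^-distribʳ-* q q (2 ^ (a / q)) ⟩
    q ^ q * (2 ^ (a / q)) ^ q    ≡⟨ cong (q ^ q *_) (^-*-assoc 2 (a / q) q) ⟩
    q ^ q * 2 ^ (a / q * q)      ≤⟨ *-monoʳ-≤ (q ^ q) (^-monoʳ-≤ 2 (m/n*n≤m a q)) ⟩
    q ^ q * 2 ^ a                ∎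
    where
    open ≤-Reasoning
    step : suc a ≤ q * 2 ^ (a / q)
    step = begin
      suc a                       ≡⟨ cong suc (m≡m%n+[m/n]*n a q) ⟩
      suc (a % q) + a / q * q     ≤⟨ +-monoˡ-≤ (a / q * q) (m%n<n a q) ⟩
      q + a / q * q               ≡⟨ *-comm (suc (a / q)) q ⟩
      q * suc (a / q)             ≤⟨ *-monoʳ-≤ q (n<2^n (a / q)) ⟩
      q * 2 ^ (a / q)             ∎

  -- The estimate d(n) ≪ n^(1/q) without real exponents, an upper bound `D` standing for d(n).
  DivisorBound : ℕ → ℕ → ℕ → Set
  DivisorBound q K n = ∃[ D ] (AtMost D (_∣ n) × D ^ q ≤ K * n)

  divisors-1 : AtMost 1 (_∣ 1)
  divisors-1 = subsingleton (λ e∣1 f∣1 → trans (∣1⇒≡1 e∣1) (sym (∣1⇒≡1 f∣1)))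

  -- The prime power multiplies d(n)^q / n by at most (a + 1)^q / p^a, which `L` dominates.
  divisorBound-step : ∀ a {K L} → Prime p → suc a ^ q ≤ L * p ^ a →
                      DivisorBound q K m → DivisorBound q (L * K) (p ^ a * m)
  divisorBound-step {p} {q} {m} a {K} {L} pp le (D , c , D^q≤Km) =
    suc a * D , divisors-p^a*m a pp c , (begin
    (suc a * D) ^ q              ≡⟨ ^-distribʳ-* q (suc a) D ⟩
    suc a ^ q * D ^ q            ≤⟨ *-mono-≤ le D^q≤Km ⟩
    L * p ^ a * (K * m)          ≡⟨ [m*n]*[o*p]≡[m*o]*[n*p] L (p ^ a) K m ⟩
    L * K * (p ^ a * m)          ∎)
    where open ≤-Reasoning

  -- All prime factors are at least 2^q. Split off one by one, with multiplicity, each multiplies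
  -- `D ^ q` by 2^q ≤ p.
  divisorBound-rough : ∀ q → r ≥ 2 ^ q → .{{_ : NonZero n}} → r Rough n → DivisorBound q 1 n
  divisorBound-rough {r} {n} q r≥2^q n-rough with factorise n
  ... | record { factors = ps ; isFactorisation = refl ; factorsPrime = primes } = go ps primes n-rough
    where
    go : ∀ ps → All Prime ps → r Rough product ps → DivisorBound q 1 (product ps)
    go []       []        _     = 1 , divisors-1 , ≤-reflexive (^-zeroˡ q)
    go (p ∷ ps) (pp ∷ pps) rough =
      subst (λ k → DivisorBound q 1 (k * product ps)) (^-identityʳ p)
      (divisorBound-step {q = q} 1 {1} {1} pp
        (≤-trans r≥2^q (≤-trans r≤p (≤-reflexive (sym (trans (+-identityʳ (p ^ 1)) (^-identityʳ p))))))
        (go ps pps (rough∧∣⇒rough rough (n∣m*n p))))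
      where
      instance _ = prime⇒nonTrivial pp
      r≤p : r ≤ p
      r≤p = rough⇒≤ (rough∧∣⇒rough rough (m∣m*n (product ps)))

  p-part : ∀ p .{{_ : NonTrivial p}} n → .{{NonZero n}} → ∃[ a ] ∃[ m ] (n ≡ p ^ a * m × p ∤ m)
  p-part p = <-rec (λ n → .{{NonZero n}} → ∃[ a ] ∃[ m ] (n ≡ p ^ a * m × p ∤ m)) step
    where
    step : ∀ n → (∀ {m} → m < n → .{{NonZero m}} → _) → .{{NonZero n}} → _
    step n rec with p ∣? n
    ... | no p∤n = 0 , n , sym (+-identityʳ n) , p∤n
    ... | yes (divides k refl) =
      let instance _ = m*n≢0⇒m≢0 k
          a , m , k≡ , p∤m = rec {k} (m<m*n k p (nonTrivial⇒n>1 p))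
      in suc a , m , trans (*-comm k p) (trans (cong (p *_) k≡) (sym (*-assoc p (p ^ a) m))) , p∤m

  -- If `r` divides the `r`-rough number `n`, it is prime, and removing its full power costs q^q by
  -- `poly≤exp` and 2^a ≤ r^a. What remains is rough for `suc r`.
  divisorBound-lower : ∀ {K} q .{{_ : NonZero q}} r .{{_ : NonTrivial r}} →
                       (∀ n → .{{NonZero n}} → suc r Rough n → DivisorBound q K n) →
                       ∀ n → .{{NonZero n}} → r Rough n → DivisorBound q (q ^ q * K) n
  divisorBound-lower {K} q r bound n rough with r ∣? n
  ... | no r∤n = let D , c , le = bound n (∤⇒rough-suc r∤n rough) in
    D , c , ≤-trans le (*-monoˡ-≤ n (m≤n*m K (q ^ q) {{m^n≢0 q q}}))
  ... | yes r∣n with p-part r n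
  ...   | a , m , refl , r∤m =
    divisorBound-step {q = q} a {K} {q ^ q} (rough∧∣⇒prime rough r∣n)
      (≤-trans (poly≤exp q a) (*-monoʳ-≤ (q ^ q) (^-monoˡ-≤ a (nonTrivial⇒n>1 r))))
      (bound m {{m*n≢0⇒n≢0 (r ^ a)}} (∤⇒rough-suc r∤m (rough∧∣⇒rough rough (n∣m*n (r ^ a)))))

  -- A prime p ≥ 2^q costs nothing, because d(p m)^q ≤ 2^q d(m)^q ≤ p d(m)^q; each of the fewer
  -- than 2^q smaller ones costs a factor q^q.
  divisorBound : ∀ q .{{_ : NonZero q}} → ∃[ K ] (∀ n → .{{NonZero n}} → DivisorBound q K n)
  divisorBound q = let K , bound = go (2 ^ q) 2 (m≤m+n (2 ^ q) 2) in
    K , λ n → bound n 2-rough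
    where
    -- The invariant gives r ≥ 2^q once the fuel `i` is spent, and the rough case takes over.
    go : ∀ i r .{{_ : NonTrivial r}} → i + r ≥ 2 ^ q →
         ∃[ K ] (∀ n → .{{NonZero n}} → r Rough n → DivisorBound q K n)
    go zero    r        r≥ = 1 , λ n → divisorBound-rough q r≥
    go (suc i) r@(2+ _) r≥ =
      let K , bound = go i (suc r) (≤-trans r≥ (≤-reflexive (sym (+-suc i r))))
      in q ^ q * K , divisorBound-lower q r bound

module Equations where
  open Counting
  open import Data.Integer.Base using (-_; _+_; _*_; _-_; ∣_∣)
  open import Data.Integer.Properties using (_≟_)
  open import Data.Nat.Divisibility using (_∣_; 0∣⇒≡0)
  open import Algebra.Properties.AbelianGroup ℤ.+-0-abelianGroup using (∙-cancelˡ; ∙-cancelʳ)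
  open import Data.Integer.Divisibility.Signed using (divides; ∣⇒∣ᵤ)
  open import Data.Integer.Tactic.RingSolver using (solve-∀)

  private variable
    P : ℕ
    a b c d x y : ℤ

  -- Roots of integer polynomials of degree at most three.

  cancel : a ≢ 0ℤ → a * b ≡ 0ℤ → b ≡ 0ℤ
  cancel {a} a≢0 ab≡0 with ℤ.i*j≡0⇒i≡0∨j≡0 a ab≡0
  ... | inj₁ a≡0 = contradiction a≡0 a≢0
  ... | inj₂ b≡0 = b≡0

  double≢0 : a ≢ 0ℤ → + 2 * a ≢ 0ℤ
  double≢0 a≢0 eq = a≢0 (cancel {+ 2} (λ ()) eq)

  -- The recurring route to an equality: an identity writes a multiple of `x - y` as a difference of
  -- two quantities known to agree.
  cancel-≡ : a ≢ 0ℤ → a * (x - y) ≡ c - d → c ≡ d → x ≡ y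
  cancel-≡ {c = c} a≢0 eq refl = ℤ.i-j≡0⇒i≡j _ _ (cancel a≢0 (trans eq (ℤ.+-inverseʳ c)))

  roots₁ : ∀ a b → a ≢ 0ℤ → AtMost 1 (λ x → a * x + b ≡ 0ℤ)
  roots₁ a b a≢0 = subsingleton (λ {x} {y} fx fy → cancel-≡ a≢0 (identity a b x y) (trans fx (sym fy)))
    where
    identity : ∀ a b x y → a * (x - y) ≡ (a * x + b) - (a * y + b)
    identity = solve-∀

  -- Here `f` and `g` are the values of one polynomial at two distinct roots, and `a` is the
  -- quotient of their difference by `x - y`, of lower degree.
  deflate : ∀ {f g : ℤ} → x ≢ y → f ≡ 0ℤ → g ≡ 0ℤ → (x - y) * a ≡ f - g → a ≡ 0ℤ
  deflate x≢y refl refl eq = cancel (λ x-y≡0 → x≢y (ℤ.i-j≡0⇒i≡j _ _ x-y≡0)) eq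

  roots₂ : ∀ a b c → a ≢ 0ℤ → AtMost 2 (λ x → a * (x * x) + b * x + c ≡ 0ℤ)
  roots₂ a b c a≢0 = remove (λ {r} fr →
    weaken (λ {x} (fx , x≢r) → deflate x≢r fx fr (identity a b c r x)) (roots₁ a (a * r + b) a≢0))
    where
    identity : ∀ a b c r x → (x - r) * (a * x + (a * r + b)) ≡
               (a * (x * x) + b * x + c) - (a * (r * r) + b * r + c)
    identity = solve-∀

  roots₃ : ∀ a b c d → a ≢ 0ℤ → AtMost 3 (λ x → a * (x * x * x) + b * (x * x) + c * x + d ≡ 0ℤ)
  roots₃ a b c d a≢0 = remove (λ {r} fr →
    weaken (λ {x} (fx , x≢r) → deflate x≢r fx fr (identity a b c d r x))
      (roots₂ a (a * r + b) (a * (r * r) + b * r + c) a≢0))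
    where
    identity : ∀ a b c d r x → (x - r) * (a * (x * x) + (a * r + b) * x + (a * (r * r) + b * r + c)) ≡
               (a * (x * x * x) + b * (x * x) + c * x + d) - (a * (r * r * r) + b * (r * r) + c * r + d)
    identity = solve-∀

  -- Power sums of a pair and the curve that they satisfy.

  σ : ℤ × ℤ → ℤ × ℤ
  σ (x , y) = x + y , x * x + y * y

  σ₄ : ℤ × ℤ → ℤ
  σ₄ (x , y) = x * x * x * x + y * y * y * y

  _≟₂_ : DecidableEquality (ℤ × ℤ)
  _≟₂_ = ≡-dec _≟_ _≟_

  -- x is a root of 2 X² - 2 u X + u² - m, and y = u - x.
  σ-fibre : ∀ s → AtMost 2 (λ p → σ p ≡ s)
  σ-fibre (u , m) = injection proj₁
    (λ { {x , y} refl → root x y })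
    (λ { {x , y} {x , z} eq eq′ refl →
           cong (x ,_) (∙-cancelˡ x y z (cong proj₁ (trans eq (sym eq′)))) })
    (roots₂ (+ 2) (- (+ 2 * u)) (u * u - m) (λ ()))
    where
    root : ∀ x y → + 2 * (x * x) + - (+ 2 * (x + y)) * x + ((x + y) * (x + y) - (x * x + y * y)) ≡ 0ℤ
    root = solve-∀

  -- 2 (x⁴ + y⁴) as a polynomial in u = x + y and m = x² + y².
  quartic : ℤ × ℤ → ℤ
  quartic (u , m) = m * m + + 2 * (u * u) * m - u * u * u * u

  quartic-σ : ∀ p → quartic (σ p) ≡ + 2 * σ₄ p
  quartic-σ (x , y) = identity x y
    where
    identity : ∀ x y → let u = x + y ; m = x * x + y * y in
      m * m + + 2 * (u * u) * m - u * u * u * u ≡ + 2 * (x * x * x * x + y * y * y * y)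
    identity = solve-∀

  Triple : Set
  Triple = ℤ × ℤ × ℤ

  Δ : Triple → ℤ
  Δ (k₁ , k₂ , k₄) = + 4 * (k₁ * k₁) * k₄ - + 2 * (k₂ * k₂ * k₂) - + 2 * (k₁ * k₁ * k₁ * k₁) * k₂

  shift : Triple → ℤ × ℤ → ℤ × ℤ
  shift (k₁ , k₂ , _) (u , m) = u - k₁ , m - k₂

  ℓ : Triple → ℤ → ℤ
  ℓ (k₁ , k₂ , _) u = (+ 2 * u - k₁) * k₁ + k₂

  cofactor : Triple → ℤ × ℤ → ℤ
  cofactor k@(k₁ , k₂ , _) (u , m) =
    + 2 * (k₁ * k₁) * (+ 2 * m - k₂) -
    (ℓ k u * ℓ k u - + 4 * ℓ k u * k₂ + + 5 * (k₂ * k₂) + k₁ * k₁ * k₁ * k₁)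

  -- The equation is linear in m with slope 2 ℓ. After multiplication by 2 k₁², the terms free of m
  -- depend on u only through 2 u k₁ = ℓ + k₁² - k₂. They form a polynomial in ℓ with constant term
  -- 2 k₂³ + 2 k₁⁴ k₂, which is moved to the other side.
  cofactor*ℓ≡Δ : ∀ k s → quartic s - quartic (shift k s) ≡ + 2 * proj₂ (proj₂ k) →
                 cofactor k s * ℓ k (proj₁ s) ≡ Δ k
  cofactor*ℓ≡Δ (k₁ , k₂ , k₄) (u , m) eq =
    trans (identity k₁ k₂ u m) (trans (cong (combine k₁ k₂) eq) (halve k₁ k₂ k₄))
    where
    combine : ℤ → ℤ → ℤ → ℤ
    combine k₁ k₂ z = + 2 * (k₁ * k₁) * z - + 2 * (k₂ * k₂ * k₂) - + 2 * (k₁ * k₁ * k₁ * k₁) * k₂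
    halve : ∀ k₁ k₂ k₄ →
      + 2 * (k₁ * k₁) * (+ 2 * k₄) - + 2 * (k₂ * k₂ * k₂) - + 2 * (k₁ * k₁ * k₁ * k₁) * k₂ ≡
      + 4 * (k₁ * k₁) * k₄ - + 2 * (k₂ * k₂ * k₂) - + 2 * (k₁ * k₁ * k₁ * k₁) * k₂
    halve = solve-∀
    identity : ∀ k₁ k₂ u m →
      let t = (+ 2 * u - k₁) * k₁ + k₂ ; v = u - k₁ ; n = m - k₂ in
      (+ 2 * (k₁ * k₁) * (+ 2 * m - k₂) -
        (t * t - + 4 * t * k₂ + + 5 * (k₂ * k₂) + k₁ * k₁ * k₁ * k₁)) * t ≡
      + 2 * (k₁ * k₁) * ((m * m + + 2 * (u * u) * m - u * u * u * u) -
                         (n * n + + 2 * (v * v) * n - v * v * v * v))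
        - + 2 * (k₂ * k₂ * k₂) - + 2 * (k₁ * k₁ * k₁ * k₁) * k₂
    identity = solve-∀

  -- For fixed u the squares of m cancel in the curve equation, which leaves slope 2 ℓ.
  slope-identity : ∀ k u m m′ →
    + 2 * ℓ k u * (m - m′) ≡
    (quartic (u , m) - quartic (shift k (u , m))) - (quartic (u , m′) - quartic (shift k (u , m′)))
  slope-identity (k₁ , k₂ , _) = identity k₁ k₂
    where
    identity : ∀ k₁ k₂ u m m′ → let v = u - k₁ ; n = m - k₂ ; n′ = m′ - k₂ in
      + 2 * ((+ 2 * u - k₁) * k₁ + k₂) * (m - m′) ≡
      ((m * m + + 2 * (u * u) * m - u * u * u * u) - (n * n + + 2 * (v * v) * n - v * v * v * v)) -
      ((m′ * m′ + + 2 * (u * u) * m′ - u * u * u * u) -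
       (n′ * n′ + + 2 * (v * v) * n′ - v * v * v * v))
    identity = solve-∀

  -- Coordinates in the box, and signed divisors.

  In : ℕ → ℤ → Set
  In P x = ∃[ i ] (i < P × x ≡ + suc i)

  Box : ℕ → ℤ × ℤ → Set
  Box P (x , y) = In P x × In P y

  below : ∀ P → AtMost P (_< P)
  below zero    = empty λ ()
  below (suc P) = weaken (λ i<1+P → split (ℕ.m<1+n⇒m<n∨m≡n i<1+P))
    (union (singleton P) (below P))
    where
    split : ∀ {i} → i < P ⊎ i ≡ P → i ≡ P ⊎ i < P
    split (inj₁ <P) = inj₂ <P
    split (inj₂ ≡P) = inj₁ ≡P

  in-count : ∀ P → AtMost P (In P)
  in-count P = injection (ℕ.pred ∘ ∣_∣) (λ { (i , i<P , refl) → i<P })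
    (λ { (i , _ , refl) (.i , _ , refl) refl → refl }) (below P)

  in-+ : In P x → In P y → In (P ℕ.+ P) (x + y)
  in-+ {P} (i , i<P , refl) (j , j<P , refl) = i ℕ.+ suc j , ℕ.+-mono-<-≤ i<P j<P , refl

  -- Adding P moves differences, which lie between 1 - P and P - 1, to positive integers that
  -- `in-count` can count.
  in-- : In P x → In P y → In (P ℕ.+ P) (x - y + + P)
  in-- {P} (i , i<P , refl) (j , j<P , refl) =
    i ℕ.+ (P ℕ.∸ suc j) , ℕ.+-mono-<-≤ i<P (ℕ.m∸n≤m P (suc j)) ,
    trans (cong (λ k → + suc i - + suc j + + k) (sym (ℕ.m+[n∸m]≡n j<P)))
          (identity (+ suc i) (+ suc j) (+ (P ℕ.∸ suc j)))
    where
    identity : ∀ a b c → a - b + (b + c) ≡ a + c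
    identity = solve-∀

  ∣∣-fibre : ∀ n → AtMost 2 (λ x → ∣ x ∣ ≡ n)
  ∣∣-fibre n = weaken (λ { {+ _} refl → inj₁ refl ; { -[1+ _ ] } refl → inj₂ refl })
    (union (singleton (+ n)) (singleton (- + n)))

  signed-divisors : ∀ {D} n → AtMost D (_∣ n) → AtMost (D ℕ.* 2) (λ x → ∣ x ∣ ∣ n)
  signed-divisors n c = fibre ℕ._≟_ ∣_∣ id c (λ b → weaken proj₂ (∣∣-fibre b))

  -- Completions of a fixed pair (x₁ , y₁).

  -- The system for p = (x₂ , x₃) and q = (y₂ , y₃) that remains once x₁ and y₁ are fixed.
  Rest : ℕ → Triple → (ℤ × ℤ) × (ℤ × ℤ) → Set
  Rest P k (p , q) =
    Box P p × Box P q × σ q ≡ shift k (σ p) × σ₄ p - σ₄ q ≡ proj₂ (proj₂ k)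

  pivot : Triple → ℤ × ℤ → ℤ
  pivot k p = ℓ k (proj₁ (σ p))

  -- As `σ q` is the shift of `σ p`, both fourth power sums are functions of `σ p` alone.
  curve : ∀ {k p q} → Rest P k (p , q) → quartic (σ p) - quartic (shift k (σ p)) ≡ + 2 * proj₂ (proj₂ k)
  curve {k = k} {p} {q} (_ , _ , σq , refl) =
    trans (cong₂ _-_ (quartic-σ p) (trans (cong quartic (sym σq)) (quartic-σ q))) (identity (σ₄ p) (σ₄ q))
    where
    identity : ∀ a b → + 2 * a - + 2 * b ≡ + 2 * (a - b)
    identity = solve-∀

  pivot∣Δ : ∀ {k p q} → Rest P k (p , q) → ∣ pivot k p ∣ ∣ ∣ Δ k ∣
  pivot∣Δ {k = k} {p} {q} r =
    ∣⇒∣ᵤ (divides (cofactor k (σ p)) (sym (cofactor*ℓ≡Δ k (σ p) (curve {k = k} {p} {q} r))))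

  -- Where ℓ ≠ 0, the linear equation for m has one solution, so u fixes `σ p`.
  σ-determined : ∀ {k p q p′ q′} → pivot k p ≢ 0ℤ → Rest P k (p , q) → Rest P k (p′ , q′) →
                 proj₁ (σ p) ≡ proj₁ (σ p′) → σ p ≡ σ p′
  σ-determined {k = k} {p} {q} {p′} {q′} t≢0 r r′ u≡u′ = cong₂ _,_ u≡u′
    (cancel-≡ (double≢0 t≢0) (slope-identity k (proj₁ (σ p)) (proj₂ (σ p)) (proj₂ (σ p′)))
      (trans (curve {k = k} {p} {q} r) (sym (subst OnCurve (sym u≡u′) (curve {k = k} {p′} {q′} r′)))))
    where
    OnCurve : ℤ → Set
    OnCurve u = let s = u , proj₂ (σ p′) in quartic s - quartic (shift k s) ≡ + 2 * proj₂ (proj₂ k)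

  module _ {k : Triple} {Q : (ℤ × ℤ) × (ℤ × ℤ) → Set} (Q⇒R : ∀ {a} → Q a → Rest P k a) where

    -- With p fixed, `σ q` is fixed as well, which leaves the two orderings of q.
    same-pair : (∀ {a a′} → Q a → Q a′ → proj₁ a ≡ proj₁ a′) → AtMost 2 Q
    same-pair same = inhabited (λ {(p , _)} Qa → injection proj₂
      (λ Qa′ → let _ , _ , σq , _ = Q⇒R Qa′ in trans σq (cong (shift k ∘ σ) (same Qa′ Qa)))
      (λ Qa Qa′ → cong₂ _,_ (same Qa Qa′))
      (σ-fibre (shift k (σ p))))

    same-σ : (∀ {a a′} → Q a → Q a′ → σ (proj₁ a) ≡ σ (proj₁ a′)) → AtMost 4 Q
    same-σ same = inhabited (λ {(p , _)} Qa → weaken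
      (λ Qa′ → let _ , _ , σq , _ = Q⇒R Qa′ in same Qa′ Qa , trans σq (cong (shift k) (same Qa′ Qa)))
      (pair _≟₂_ (σ-fibre (σ p)) (σ-fibre (shift k (σ p)))))

  -- ℓ is linear in u with slope 2 k₁.
  pivot-determines-sum : ∀ {k p p′} → proj₁ k ≢ 0ℤ → pivot k p ≡ pivot k p′ →
                         proj₁ (σ p) ≡ proj₁ (σ p′)
  pivot-determines-sum {k₁ , k₂ , _} {x , y} {x′ , y′} k₁≢0 =
    cancel-≡ (double≢0 k₁≢0) (identity k₁ k₂ (x + y) (x′ + y′))
    where
    identity : ∀ k₁ k₂ u u′ →
      + 2 * k₁ * (u - u′) ≡ ((+ 2 * u - k₁) * k₁ + k₂) - ((+ 2 * u′ - k₁) * k₁ + k₂)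
    identity = solve-∀

  -- ℓ is a signed divisor of Δ. Since k₁ ≠ 0 it fixes u, and since ℓ ≠ 0 this fixes m. The 2 counts
  -- signs, the 4 orderings of p and of q.
  rest-divisor : ∀ {D} k → proj₁ k ≢ 0ℤ → Δ k ≢ 0ℤ → AtMost D (_∣ ∣ Δ k ∣) →
                 AtMost (D ℕ.* 2 ℕ.* 4) (Rest P k)
  rest-divisor {P} k k₁≢0 Δ≢0 c = fibre _≟_ (pivot k ∘ proj₁) pivot∣Δ′ (signed-divisors ∣ Δ k ∣ c)
    (λ t → same-σ proj₁ (λ { {p , q} {p′ , q′} (r , eq) (r′ , eq′) →
      σ-determined {k = k} {p} {q} {p′} {q′} (pivot≢0 r) r r′
        (pivot-determines-sum {k} {p} {p′} k₁≢0 (trans eq (sym eq′))) }))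
    where
    pivot∣Δ′ : ∀ {a} → Rest P k a → ∣ pivot k (proj₁ a) ∣ ∣ ∣ Δ k ∣
    pivot∣Δ′ {_ , q} = pivot∣Δ {k = k} {q = q}
    pivot≢0 : ∀ {p q} → Rest P k (p , q) → pivot k p ≢ 0ℤ
    pivot≢0 {p} {q} r eq =
      Δ≢0 (ℤ.∣i∣≡0⇒i≡0 (0∣⇒≡0 (subst (_∣ ∣ Δ k ∣) (cong ∣_∣ eq) (pivot∣Δ {k = k} {q = q} r))))

  -- The sum u takes at most 2 P values, and each fixes `σ p`.
  rest-generic : ∀ k → AtMost ((P ℕ.+ P) ℕ.* 4) (λ a → Rest P k a × pivot k (proj₁ a) ≢ 0ℤ)
  rest-generic {P} k = fibre _≟_ (proj₁ ∘ σ ∘ proj₁)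
    (λ { (((x∈ , y∈) , _) , _) → in-+ x∈ y∈ }) (in-count (P ℕ.+ P))
    (λ u → same-σ (proj₁ ∘ proj₁) (λ { {p , q} {p′ , q′} ((r , t≢0) , eq) ((r′ , _) , eq′) →
       σ-determined {k = k} {p} {q} {p′} {q′} t≢0 r r′ (trans eq (sym eq′)) }))

  -- The condition ℓ = 0 pins down u, so x₂ determines x₃.
  rest-vertical : ∀ k → proj₁ k ≢ 0ℤ → AtMost (P ℕ.* 2) (λ a → Rest P k a × pivot k (proj₁ a) ≡ 0ℤ)
  rest-vertical {P} k k₁≢0 = fibre _≟_ (proj₁ ∘ proj₁) (λ { (((x∈ , _) , _) , _) → x∈ }) (in-count P)
    (λ x → same-pair (proj₁ ∘ proj₁)
      (λ { {(x , y) , _} {(.x , y′) , _} ((_ , t≡0) , refl) ((_ , t′≡0) , refl) →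
        cong (x ,_) (∙-cancelˡ x y y′
          (pivot-determines-sum {k} {x , y} {x , y′} k₁≢0 (trans t≡0 (sym t′≡0)))) }))

  rest-trivial : ∀ k → AtMost (P ℕ.* P ℕ.* 2) (Rest P k)
  rest-trivial {P} k = fibre _≟₂_ proj₁ proj₁ (pair _≟_ (in-count P) (in-count P))
    (λ p → same-pair proj₁ (λ { (_ , eq) (_ , eq′) → trans eq (sym eq′) }))

  -- Pairs (x₁ , y₁) with k₁ Δ = 0.

  reduce : Triple → ℤ × ℤ → Triple
  reduce (h₁ , h₂ , h₄) (x , y) =
    h₁ - (x - y) , h₂ - (x * x - y * y) , h₄ - (x * x * x * x - y * y * y * y)

  diff : ℤ × ℤ → ℤ
  diff (x , y) = x - y

  sum-diff-injective : ∀ {p p′} → proj₁ (σ p) ≡ proj₁ (σ p′) → diff p ≡ diff p′ → p ≡ p′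
  sum-diff-injective {x , y} {x′ , y′} s≡ d≡ = cong₂ _,_
    (cancel-≡ {+ 2} (λ ()) (identity₁ x y x′ y′) (cong₂ _+_ s≡ d≡))
    (cancel-≡ {+ 2} (λ ()) (identity₂ x y x′ y′) (cong₂ _-_ s≡ d≡))
    where
    identity₁ : ∀ x y x′ y′ → + 2 * (x - x′) ≡ ((x + y) + (x - y)) - ((x′ + y′) + (x′ - y′))
    identity₁ = solve-∀
    identity₂ : ∀ x y x′ y′ → + 2 * (y - y′) ≡ ((x + y) - (x - y)) - ((x′ + y′) - (x′ - y′))
    identity₂ = solve-∀

  -- With d fixed, k₁ is constant, k₂ = h₂ - d s and k₄ = h₄ - d s (s² + d²) / 2. The leading
  -- coefficient 2 d (d² - k²) factors because k = h₁ - d.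
  Δ-identity : ∀ h₁ h₂ h₄ x y → let d = x - y ; s = x + y ; k = h₁ - d in
    Δ (reduce (h₁ , h₂ , h₄) (x , y)) ≡
    + 2 * d * h₁ * (+ 2 * d - h₁) * (s * s * s) + - (+ 6 * h₂ * (d * d)) * (s * s)
      + + 2 * d * (k * k * k * k - k * k * (d * d) + + 3 * (h₂ * h₂)) * s
      + (+ 4 * (k * k) * h₄ - + 2 * (h₂ * h₂ * h₂) - + 2 * (k * k * k * k) * h₂)
  Δ-identity = identity
    where
    identity : ∀ h₁ h₂ h₄ x y →
      let d = x - y ; s = x + y ; k₁ = h₁ - d ; k₂ = h₂ - (x * x - y * y)
          k₄ = h₄ - (x * x * x * x - y * y * y * y) in
        + 4 * (k₁ * k₁) * k₄ - + 2 * (k₂ * k₂ * k₂) - + 2 * (k₁ * k₁ * k₁ * k₁) * k₂ ≡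
        + 2 * d * h₁ * (+ 2 * d - h₁) * (s * s * s) + - (+ 6 * h₂ * (d * d)) * (s * s)
          + + 2 * d * (k₁ * k₁ * k₁ * k₁ - k₁ * k₁ * (d * d) + + 3 * (h₂ * h₂)) * s
          + (+ 4 * (k₁ * k₁) * h₄ - + 2 * (h₂ * h₂ * h₂) - + 2 * (k₁ * k₁ * k₁ * k₁) * h₂)
    identity = solve-∀

  Δ-identity-h₁≡0 : ∀ h₂ h₄ x y → let d = x - y ; s = x + y in
    Δ (reduce (0ℤ , h₂ , h₄) (x , y)) ≡
    - (+ 6 * h₂ * (d * d)) * (s * s) + + 6 * d * (h₂ * h₂) * s
      + (+ 4 * (d * d) * h₄ - + 2 * (h₂ * h₂ * h₂) - + 2 * (d * d * d * d) * h₂)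
  Δ-identity-h₁≡0 = identity
    where
    identity : ∀ h₂ h₄ x y →
      let d = x - y ; s = x + y ; k₁ = 0ℤ - d ; k₂ = h₂ - (x * x - y * y)
          k₄ = h₄ - (x * x * x * x - y * y * y * y) in
        + 4 * (k₁ * k₁) * k₄ - + 2 * (k₂ * k₂ * k₂) - + 2 * (k₁ * k₁ * k₁ * k₁) * k₂ ≡
        - (+ 6 * h₂ * (d * d)) * (s * s) + + 6 * d * (h₂ * h₂) * s
          + (+ 4 * (d * d) * h₄ - + 2 * (h₂ * h₂ * h₂) - + 2 * (d * d * d * d) * h₂)
    identity = solve-∀

  Δ-identity-h₁≡h₂≡0 : ∀ h₄ x y → let d = x - y in
    Δ (reduce (0ℤ , 0ℤ , h₄) (x , y)) ≡ + 4 * (d * d) * h₄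
  Δ-identity-h₁≡h₂≡0 = identity
    where
    identity : ∀ h₄ x y →
      let d = x - y ; k₁ = 0ℤ - d ; k₂ = 0ℤ - (x * x - y * y)
          k₄ = h₄ - (x * x * x * x - y * y * y * y) in
        + 4 * (k₁ * k₁) * k₄ - + 2 * (k₂ * k₂ * k₂) - + 2 * (k₁ * k₁ * k₁ * k₁) * k₂ ≡
        + 4 * (d * d) * h₄
    identity = solve-∀

  *≢0 : ∀ {a b} → a ≢ 0ℤ → b ≢ 0ℤ → a * b ≢ 0ℤ
  *≢0 a≢0 b≢0 eq = b≢0 (cancel a≢0 eq)

  neg≢0 : ∀ {a} → a ≢ 0ℤ → - a ≢ 0ℤ
  neg≢0 a≢0 eq = a≢0 (ℤ.neg-injective eq)

  -- The first nonzero entry of `h` decides the degree in s: a cubic for h₁, a quadratic with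
  -- leading coefficient -6 h₂ d² for h₂, and the nonzero constant 4 d² h₄ for h₄.
  Δ-zeros : ∀ h d → h ≢ (0ℤ , 0ℤ , 0ℤ) → d ≢ 0ℤ → + 2 * d - proj₁ h ≢ 0ℤ →
            AtMost 3 (λ p → Δ (reduce h p) ≡ 0ℤ × diff p ≡ d)
  Δ-zeros (h₁ , h₂ , h₄) d h≢0 d≢0 2d≢h₁ with h₁ ≟ 0ℤ | h₂ ≟ 0ℤ
  ... | no h₁≢0 | _ = let k = h₁ - d in injection (proj₁ ∘ σ)
    (λ { {x , y} (Δ≡0 , refl) → trans (sym (Δ-identity h₁ h₂ h₄ x y)) Δ≡0 })
    (λ { (_ , d≡) (_ , d≡′) s≡ → sum-diff-injective s≡ (trans d≡ (sym d≡′)) })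
    (roots₃ (+ 2 * d * h₁ * (+ 2 * d - h₁)) (- (+ 6 * h₂ * (d * d)))
      (+ 2 * d * (k * k * k * k - k * k * (d * d) + + 3 * (h₂ * h₂)))
      (+ 4 * (k * k) * h₄ - + 2 * (h₂ * h₂ * h₂) - + 2 * (k * k * k * k) * h₂)
      (*≢0 (*≢0 (double≢0 d≢0) h₁≢0) 2d≢h₁))
  ... | yes refl | no h₂≢0 = relax (ℕ.n≤1+n 2) (injection (proj₁ ∘ σ)
    (λ { {x , y} (Δ≡0 , refl) → trans (sym (Δ-identity-h₁≡0 h₂ h₄ x y)) Δ≡0 })
    (λ { (_ , d≡) (_ , d≡′) s≡ → sum-diff-injective s≡ (trans d≡ (sym d≡′)) })
    (roots₂ (- (+ 6 * h₂ * (d * d))) (+ 6 * d * (h₂ * h₂))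
      (+ 4 * (d * d) * h₄ - + 2 * (h₂ * h₂ * h₂) - + 2 * (d * d * d * d) * h₂)
      (neg≢0 (*≢0 (*≢0 {+ 6} (λ ()) h₂≢0) (*≢0 d≢0 d≢0)))))
  ... | yes refl | yes refl = relax z≤n (empty
    (λ { {x , y} (Δ≡0 , refl) → *≢0 (*≢0 {+ 4} (λ ()) (*≢0 d≢0 d≢0)) (λ { refl → h≢0 refl })
           (trans (sym (Δ-identity-h₁≡h₂≡0 h₄ x y)) Δ≡0) }))

  -- Doubling the difference lets one lemma serve the lines d = h₁, d = 0 and 2 d = h₁.
  line : ∀ c → AtMost P (λ p → Box P p × + 2 * diff p ≡ c)
  line {P} c = injection proj₁ (proj₁ ∘ proj₁)
    (λ { {x , y} {.x , y′} (_ , eq) (_ , eq′) refl →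
           cong (x ,_) (cancel-≡ {+ 2} (λ ()) (identity x y y′) (trans eq′ (sym eq))) })
    (in-count P)
    where
    identity : ∀ x y y′ → + 2 * (y - y′) ≡ + 2 * (x - y′) - + 2 * (x - y)
    identity = solve-∀

  Degenerate : Triple → Set
  Degenerate k = proj₁ k ≡ 0ℤ ⊎ Δ k ≡ 0ℤ

  -- Three lines carry at most P pairs each. Off them, each of at most 2 P values of d admits three
  -- pairs by `Δ-zeros`.
  degenerate-count : ∀ h → h ≢ (0ℤ , 0ℤ , 0ℤ) →
    AtMost (P ℕ.+ (P ℕ.+ (P ℕ.+ (P ℕ.+ P) ℕ.* 3))) (λ p → Box P p × Degenerate (reduce h p))
  degenerate-count {P} h h≢0 = weaken classify
    (union (line (+ 2 * proj₁ h)) (union (line 0ℤ) (union (line (proj₁ h)) offLines)))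
    where
    OffLines : ℤ × ℤ → Set
    OffLines p = Box P p × Δ (reduce h p) ≡ 0ℤ × diff p ≢ 0ℤ × + 2 * diff p - proj₁ h ≢ 0ℤ
    offLines : AtMost ((P ℕ.+ P) ℕ.* 3) OffLines
    offLines = fibre _≟_ (λ p → diff p + + P)
      (λ { ((x∈ , y∈) , _) → in-- x∈ y∈ }) (in-count (P ℕ.+ P))
      (λ b → inhabited (λ { {p} ((_ , _ , d≢0 , 2d≢h₁) , eq) → weaken
        (λ { {p′} ((_ , Δ≡0 , _) , eq′) → Δ≡0 , ∙-cancelʳ (+ P) (diff p′) (diff p) (trans eq′ (sym eq)) })
        (Δ-zeros h (diff p) h≢0 d≢0 2d≢h₁) }))
    classify : ∀ {p} → Box P p × Degenerate (reduce h p) →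
      (Box P p × + 2 * diff p ≡ + 2 * proj₁ h) ⊎ (Box P p × + 2 * diff p ≡ 0ℤ) ⊎
      (Box P p × + 2 * diff p ≡ proj₁ h) ⊎ OffLines p
    classify {p} (p∈ , inj₁ k₁≡0) = inj₁ (p∈ , cong (+ 2 *_) (sym (ℤ.i-j≡0⇒i≡j _ _ k₁≡0)))
    classify {p} (p∈ , inj₂ Δ≡0) with diff p ≟ 0ℤ | + 2 * diff p - proj₁ h ≟ 0ℤ
    ... | yes d≡0 | _        = inj₂ (inj₁ (p∈ , cong (+ 2 *_) d≡0))
    ... | no _    | yes 2d≡h = inj₂ (inj₂ (inj₁ (p∈ , ℤ.i-j≡0⇒i≡j _ _ 2d≡h)))
    ... | no d≢0  | no 2d≢h  = inj₂ (inj₂ (inj₂ (p∈ , Δ≡0 , d≢0 , 2d≢h)))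

  -- The count of all solutions.

  Full : ℕ → Triple → (ℤ × ℤ) × ((ℤ × ℤ) × (ℤ × ℤ)) → Set
  Full P h (p , r) = Box P p × Rest P (reduce h p) r

  -- For such a pair `σ q` equals `σ p`, so q is p up to order.
  Trivial : Triple → ℤ × ℤ → Set
  Trivial h p = proj₁ h ≢ 0ℤ × proj₁ (reduce h p) ≡ 0ℤ × proj₁ (proj₂ (reduce h p)) ≡ 0ℤ

  -- The difference is h₁ ≠ 0, and h₁ s = h₂ then fixes the sum s.
  trivial-count : ∀ h → AtMost 1 (Trivial h)
  trivial-count (h₁ , h₂ , h₄) = subsingleton (λ { {x , y} {x′ , y′} (h₁≢0 , eq₁ , eq₂) (_ , eq₁′ , eq₂′) →
    let d≡  = ℤ.i-j≡0⇒i≡j h₁ (x - y) eq₁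
        d≡′ = ℤ.i-j≡0⇒i≡j h₁ (x′ - y′) eq₁′ in
    sum-diff-injective (cancel-≡ h₁≢0 (distrib h₁ (x + y) (x′ + y′))
      (trans (h₁s≡h₂ {x} {y} d≡ eq₂) (sym (h₁s≡h₂ {x′} {y′} d≡′ eq₂′)))) (trans (sym d≡) d≡′) })
    where
    distrib : ∀ a b c → a * (b - c) ≡ a * b - a * c
    distrib = solve-∀
    factor : ∀ x y → (x - y) * (x + y) ≡ x * x - y * y
    factor = solve-∀
    h₁s≡h₂ : ∀ {x y} → h₁ ≡ x - y → h₂ - (x * x - y * y) ≡ 0ℤ → h₁ * (x + y) ≡ h₂
    h₁s≡h₂ {x} {y} d≡ eq₂ =
      trans (cong (_* (x + y)) d≡) (trans (factor x y) (sym (ℤ.i-j≡0⇒i≡j _ _ eq₂)))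

  -- For k₁ = 0 the form ℓ reduces to k₂, so k₂ = 0, and the curve equation gives k₄ = 0. If also h₁
  -- = 0, then x₁ = y₁ and h = 0.
  full⇒trivial : ∀ h {a} → h ≢ (0ℤ , 0ℤ , 0ℤ) → Full P h a → proj₁ (reduce h (proj₁ a)) ≡ 0ℤ →
                 pivot (reduce h (proj₁ a)) (proj₁ (proj₂ a)) ≡ 0ℤ → Trivial h (proj₁ a)
  full⇒trivial (h₁ , h₂ , h₄) {(x , y) , (p , q)} h≢0 (_ , r) k₁≡0 t≡0 = h₁≢0 , k₁≡0 , k₂≡0
    where
    k₁ = h₁ - (x - y)
    k₂ = h₂ - (x * x - y * y)
    k₄ = h₄ - (x * x * x * x - y * y * y * y)
    simplify : ∀ {k₁} k₂ u → k₁ ≡ 0ℤ → k₂ ≡ (+ 2 * u - k₁) * k₁ + k₂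
    simplify k₂ u refl = sym (trans (cong (_+ k₂) (ℤ.*-zeroʳ (+ 2 * u - 0ℤ))) (ℤ.+-identityˡ k₂))
    k₂≡0 : k₂ ≡ 0ℤ
    k₂≡0 = trans (simplify k₂ (proj₁ (σ p)) k₁≡0) t≡0
    unshifted : ∀ {k₁ k₂} u m → k₁ ≡ 0ℤ → k₂ ≡ 0ℤ → quartic (u , m) - quartic (u - k₁ , m - k₂) ≡ 0ℤ
    unshifted u m refl refl =
      ℤ.i≡j⇒i-j≡0 (cong quartic (cong₂ _,_ (sym (ℤ.+-identityʳ u)) (sym (ℤ.+-identityʳ m))))
    k₄≡0 : k₄ ≡ 0ℤ
    k₄≡0 = cancel {+ 2} (λ ())
      (trans (sym (curve {k = k₁ , k₂ , k₄} {p} {q} r)) (unshifted (proj₁ (σ p)) (proj₂ (σ p)) k₁≡0 k₂≡0))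
    h₁≢0 : h₁ ≢ 0ℤ
    h₁≢0 h₁≡0 = h≢0 (cong₂ _,_ h₁≡0 (cong₂ _,_
        (trans (ℤ.i-j≡0⇒i≡j _ _ k₂≡0) (ℤ.i≡j⇒i-j≡0 (cong (λ z → z * z) x≡y)))
        (trans (ℤ.i-j≡0⇒i≡j _ _ k₄≡0) (ℤ.i≡j⇒i-j≡0 (cong (λ z → z * z * z * z) x≡y)))))
      where
      x≡y : x ≡ y
      x≡y = ℤ.i-j≡0⇒i≡j x y (trans (sym (ℤ.i-j≡0⇒i≡j _ _ k₁≡0)) h₁≡0)

  -- The summands are the cases k₁ Δ ≠ 0, degenerate with ℓ ≠ 0, degenerate with ℓ = 0 ≠ k₁, and ℓ =
  -- k₁ = 0.
  full-count : ∀ {E} h → h ≢ (0ℤ , 0ℤ , 0ℤ) →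
    (∀ k → proj₁ k ≢ 0ℤ → Δ k ≢ 0ℤ → AtMost E (Rest P k)) →
    let N = P ℕ.+ (P ℕ.+ (P ℕ.+ (P ℕ.+ P) ℕ.* 3)) in
    AtMost (P ℕ.* P ℕ.* E ℕ.+
             (N ℕ.* ((P ℕ.+ P) ℕ.* 4) ℕ.+ (N ℕ.* (P ℕ.* 2) ℕ.+ 1 ℕ.* (P ℕ.* P ℕ.* 2)))) (Full P h)
  full-count {P} h h≢0 c = weaken classify
    (union (fibre {P = Regular} _≟₂_ proj₁ (λ (_ , _ , p∈ , _) → p∈)
              (pair _≟_ (in-count P) (in-count P)) regular)
    (union (fibre {P = Generic} _≟₂_ proj₁ (λ (deg , _ , p∈ , _) → p∈ , deg)
              (degenerate-count h h≢0) generic)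
    (union (fibre {P = Vertical} _≟₂_ proj₁ (λ (deg , _ , _ , p∈ , _) → p∈ , deg)
              (degenerate-count h h≢0) vertical)
           (fibre {P = Isolated} _≟₂_ proj₁ proj₁ (trivial-count h) isolated))))
    where
    Regular Generic Vertical Isolated : (ℤ × ℤ) × ((ℤ × ℤ) × (ℤ × ℤ)) → Set
    Regular  a@(p , _)         = let k = reduce h p in proj₁ k ≢ 0ℤ × Δ k ≢ 0ℤ × Full P h a
    Generic  a@(p , (p′ , _)) = let k = reduce h p in Degenerate k × pivot k p′ ≢ 0ℤ × Full P h a
    Vertical a@(p , (p′ , _)) =
      let k = reduce h p in Degenerate k × proj₁ k ≢ 0ℤ × pivot k p′ ≡ 0ℤ × Full P h a
    Isolated a@(p , _)         = Trivial h p × Full P h a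
    over : ∀ {n} {Q : _ → Set} {S : _ → Set} p → (∀ {r} → Q (p , r) → S r) → AtMost n S →
           AtMost n (λ a → Q a × proj₁ a ≡ p)
    over p Q⇒S =
      injection proj₂ (λ { (Qa , refl) → Q⇒S Qa }) (λ { (_ , refl) (_ , refl) refl → refl })
    regular : ∀ p → AtMost _ (λ a → Regular a × proj₁ a ≡ p)
    regular p = inhabited (λ { ((k₁≢0 , Δ≢0 , _) , refl) →
      over {Q = Regular} p (λ (_ , _ , _ , r) → r) (c (reduce h p) k₁≢0 Δ≢0) })
    generic : ∀ p → AtMost _ (λ a → Generic a × proj₁ a ≡ p)
    generic p = over {Q = Generic} p (λ (_ , t≢0 , _ , r) → r , t≢0) (rest-generic (reduce h p))
    vertical : ∀ p → AtMost _ (λ a → Vertical a × proj₁ a ≡ p)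
    vertical p = inhabited (λ { ((_ , k₁≢0 , _) , refl) →
      over {Q = Vertical} p (λ (_ , _ , t≡0 , _ , r) → r , t≡0) (rest-vertical (reduce h p) k₁≢0) })
    isolated : ∀ p → AtMost _ (λ a → Isolated a × proj₁ a ≡ p)
    isolated p = over {Q = Isolated} p (λ (_ , _ , r) → r) (rest-trivial (reduce h p))
    classify : ∀ {a} → Full P h a → Regular a ⊎ Generic a ⊎ Vertical a ⊎ Isolated a
    classify {p , (p′ , _)} s
      with proj₁ (reduce h p) ≟ 0ℤ | Δ (reduce h p) ≟ 0ℤ | pivot (reduce h p) p′ ≟ 0ℤ
    ... | no k₁≢0  | no Δ≢0  | _       = inj₁ (k₁≢0 , Δ≢0 , s)
    ... | yes k₁≡0 | _       | no t≢0  = inj₂ (inj₁ (inj₁ k₁≡0 , t≢0 , s))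
    ... | yes k₁≡0 | _       | yes t≡0 = inj₂ (inj₂ (inj₂ (full⇒trivial h h≢0 s k₁≡0 t≡0 , s)))
    ... | no _     | yes Δ≡0 | no t≢0  = inj₂ (inj₁ (inj₂ Δ≡0 , t≢0 , s))
    ... | no k₁≢0  | yes Δ≡0 | yes t≡0 = inj₂ (inj₂ (inj₁ (inj₂ Δ≡0 , k₁≢0 , t≡0 , s)))

  -‿swap : ∀ a {b} c → b ≡ a - c → c ≡ a - b
  -‿swap a c refl = identity a c
    where
    identity : ∀ a c → c ≡ a - (a - c)
    identity = solve-∀

  -- The list behind `T₃`.

  vectors-! : ∀ {A : Set} n {as : List A} → Unique as → Unique (vectors n as)
  vectors-! zero    as! = [] ∷ []
  vectors-! (suc n) as! = Unique.cartesianProductWith⁺ _∷_ ∷-injective as! (vectors-! n as!)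

  ∈-vectors⁻ : ∀ {A : Set} n {as : List A} {v} → v ∈ vectors n as → Vec.All (_∈ as) v
  ∈-vectors⁻ zero    (here refl) = Vec.[]
  ∈-vectors⁻ (suc n) {as} v∈ with ∈-cartesianProductWith⁻ _∷_ as (vectors n as) v∈
  ... | _ , _ , a∈ , w∈ , refl = a∈ Vec.∷ ∈-vectors⁻ n w∈

  interval-! : ∀ P → Unique (interval P)
  interval-! P = Unique.map⁺ (λ { refl → refl }) (Unique.upTo⁺ P)

  ∈-interval⁻ : ∀ {x} → x ∈ interval P → In P x
  ∈-interval⁻ x∈ with ∈-map⁻ _ x∈
  ... | i , i∈ , eq = i , ∈-upTo⁻ i∈ , eq

  T₃≤ : ∀ {n} h → AtMost n (Full P h) → T₃ P h ≤ n
  T₃≤ {P} {n} h c = bound (filter (solution? h) pairs) (Unique.filter⁺ (solution? h) pairs!)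
                          (All.tabulate (∈-filter⁻ (solution? h)))
    where
    box   = vectors 3 (interval P)
    pairs = cartesianProduct box box
    pairs! : Unique pairs
    pairs! = Unique.cartesianProduct⁺ (vectors-! 3 (interval-! P)) (vectors-! 3 (interval-! P))
    regroup : Vec ℤ 3 × Vec ℤ 3 → (ℤ × ℤ) × ((ℤ × ℤ) × (ℤ × ℤ))
    regroup (x₁ ∷ x₂ ∷ x₃ ∷ [] , y₁ ∷ y₂ ∷ y₃ ∷ []) = (x₁ , y₁) , ((x₂ , x₃) , (y₂ , y₃))
    bound : AtMost n (λ xy → xy ∈ pairs × Solution h xy)
    bound = injection regroup full inj c
      where
      inj : ∀ {v w} → v ∈ pairs × Solution h v → w ∈ pairs × Solution h w →
            regroup v ≡ regroup w → v ≡ w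
      inj {_ ∷ _ ∷ _ ∷ [] , _ ∷ _ ∷ _ ∷ []} {_ ∷ _ ∷ _ ∷ [] , _ ∷ _ ∷ _ ∷ []} _ _ refl = refl
      full : ∀ {v} → v ∈ pairs × Solution h v → Full P h (regroup v)
      full {x₁ ∷ x₂ ∷ x₃ ∷ [] , y₁ ∷ y₂ ∷ y₃ ∷ []} (v∈ , refl , refl , refl)
        with ∈-cartesianProduct⁻ box box v∈
      ... | x∈ , y∈ with ∈-vectors⁻ 3 x∈ | ∈-vectors⁻ 3 y∈
      ... | x₁∈ Vec.∷ x₂∈ Vec.∷ x₃∈ Vec.∷ Vec.[] | y₁∈ Vec.∷ y₂∈ Vec.∷ y₃∈ Vec.∷ Vec.[] =
        (∈-interval⁻ x₁∈ , ∈-interval⁻ y₁∈) , (∈-interval⁻ x₂∈ , ∈-interval⁻ x₃∈) ,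
        (∈-interval⁻ y₂∈ , ∈-interval⁻ y₃∈) ,
        cong₂ _,_ (linear x₁ x₂ x₃ y₁ y₂ y₃) (quadratic x₁ x₂ x₃ y₁ y₂ y₃) ,
        biquadratic x₁ x₂ x₃ y₁ y₂ y₃
        where
        -- The factors `+ 1` and the final `0ℤ` are what the powers and the fold in `powerDiff`
        -- compute to.
        linear : ∀ x₁ x₂ x₃ y₁ y₂ y₃ → y₂ + y₃ ≡
          (x₂ + x₃) - ((x₁ * + 1 - y₁ * + 1 + (x₂ * + 1 - y₂ * + 1 + (x₃ * + 1 - y₃ * + 1 + 0ℤ)))
                       - (x₁ - y₁))
        linear = solve-∀
        quadratic : ∀ x₁ x₂ x₃ y₁ y₂ y₃ → y₂ * y₂ + y₃ * y₃ ≡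
          (x₂ * x₂ + x₃ * x₃) - ((x₁ * (x₁ * + 1) - y₁ * (y₁ * + 1) +
            (x₂ * (x₂ * + 1) - y₂ * (y₂ * + 1) + (x₃ * (x₃ * + 1) - y₃ * (y₃ * + 1) + 0ℤ)))
            - (x₁ * x₁ - y₁ * y₁))
        quadratic = solve-∀
        biquadratic : ∀ x₁ x₂ x₃ y₁ y₂ y₃ →
          (x₂ * x₂ * x₂ * x₂ + x₃ * x₃ * x₃ * x₃) - (y₂ * y₂ * y₂ * y₂ + y₃ * y₃ * y₃ * y₃) ≡
          (x₁ * (x₁ * (x₁ * (x₁ * + 1))) - y₁ * (y₁ * (y₁ * (y₁ * + 1))) +
            (x₂ * (x₂ * (x₂ * (x₂ * + 1))) - y₂ * (y₂ * (y₂ * (y₂ * + 1))) +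
              (x₃ * (x₃ * (x₃ * (x₃ * + 1))) - y₃ * (y₃ * (y₃ * (y₃ * + 1))) + 0ℤ)))
            - (x₁ * x₁ * x₁ * x₁ - y₁ * y₁ * y₁ * y₁)
        biquadratic = solve-∀

open Counting
open Divisors
open Equations
open import Data.Integer.Base using (∣_∣)
open import Data.Nat.Base
open import Data.Nat.Properties
open import Data.Nat.Tactic.RingSolver using (solve-∀)

-- The size of Δ.

private variable
  P : ℕ

-- A record rather than a synonym, so that i can be inferred from a bound on it.
record Bounded (i : ℤ) (a : ℕ) : Set where
  constructor bounded
  field abs≤ : ∣ i ∣ ≤ a

module _ {i j : ℤ} {a b : ℕ} where
  _⊕_ : Bounded i a → Bounded j b → Bounded (i ℤ.+ j) (a + b)
  bounded i≤a ⊕ bounded j≤b = bounded (≤-trans (ℤ.∣i+j∣≤∣i∣+∣j∣ i j) (+-mono-≤ i≤a j≤b))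
  _⊖_ : Bounded i a → Bounded j b → Bounded (i ℤ.- j) (a + b)
  bounded i≤a ⊖ bounded j≤b = bounded (≤-trans (ℤ.∣i-j∣≤∣i∣+∣j∣ i j) (+-mono-≤ i≤a j≤b))
  _⊛_ : Bounded i a → Bounded j b → Bounded (i ℤ.* j) (a * b)
  bounded i≤a ⊛ bounded j≤b =
    bounded (≤-trans (≤-reflexive (ℤ.∣i*j∣≡∣i∣*∣j∣ i j)) (*-mono-≤ i≤a j≤b))
  infixl 6 _⊕_ _⊖_
  infixl 7 _⊛_

numeral : ∀ n → Bounded (+ n) n
numeral n = bounded ≤-refl

-- A solution forces |kⱼ| ≤ 4 Pʲ, whatever h is, and 4 · 4² · 4 + 2 · 4³ + 2 · 4⁴ · 4 = 2432. This
-- keeps the implied constant independent of h.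
Δ-bound : ∀ {k a} → Rest P k a → ∣ Δ k ∣ ≤ 2432 * P ^ 6
Δ-bound {P} {k₁ , k₂ , k₄} {(x , x′) , (y , y′)} ((x∈ , x′∈) , (y∈ , y′∈) , σq , σ₄≡) =
  ≤-trans (Bounded.abs≤ (numeral 4 ⊛ (K₁ ⊛ K₁) ⊛ K₄ ⊖ numeral 2 ⊛ (K₂ ⊛ K₂ ⊛ K₂)
                           ⊖ numeral 2 ⊛ (K₁ ⊛ K₁ ⊛ K₁ ⊛ K₁) ⊛ K₂))
    (≤-reflexive (arithmetic P))
  where
  in≤ : ∀ {x} → In P x → Bounded x P
  in≤ (_ , i<P , refl) = bounded i<P
  X  = in≤ x∈
  X′ = in≤ x′∈
  Y  = in≤ y∈
  Y′ = in≤ y′∈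
  K₁ = subst (λ k → Bounded k ((P + P) + (P + P)))
    (sym (-‿swap (x ℤ.+ x′) k₁ (cong proj₁ σq))) ((X ⊕ X′) ⊖ (Y ⊕ Y′))
  K₂ = subst (λ k → Bounded k ((P * P + P * P) + (P * P + P * P)))
    (sym (-‿swap (x ℤ.* x ℤ.+ x′ ℤ.* x′) k₂ (cong proj₂ σq))) ((X ⊛ X ⊕ X′ ⊛ X′) ⊖ (Y ⊛ Y ⊕ Y′ ⊛ Y′))
  K₄ = subst (λ k → Bounded k ((P * P * P * P + P * P * P * P) + (P * P * P * P + P * P * P * P)))
    σ₄≡ ((X ⊛ X ⊛ X ⊛ X ⊕ X′ ⊛ X′ ⊛ X′ ⊛ X′) ⊖ (Y ⊛ Y ⊛ Y ⊛ Y ⊕ Y′ ⊛ Y′ ⊛ Y′ ⊛ Y′))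
  arithmetic : ∀ P → let a = (P + P) + (P + P) ; b = (P * P + P * P) + (P * P + P * P)
                         c = (P * P * P * P + P * P * P * P) + (P * P * P * P + P * P * P * P) in
    4 * (a * a) * c + 2 * (b * b * b) + 2 * (a * a * a * a) * b ≡ 2432 * (P * (P * (P * (P * (P * (P * 1))))))
  arithmetic = solve-∀

-- Rational exponents.

^-cancelʳ-≤ : ∀ q .{{_ : NonZero q}} {m n} → m ^ q ≤ n ^ q → m ≤ n
^-cancelʳ-≤ q {m} {n} le with m ≤? n
... | yes m≤n = m≤n
... | no  m≰n = contradiction le (<⇒≱ (^-monoˡ-< q (≰⇒> m≰n)))

integerRoot : ∀ q .{{_ : NonZero q}} X → ∃[ E ] (E ^ q ≤ X × X < suc E ^ q)
integerRoot q@(suc _) zero = 0 , z≤n , ≤-reflexive (sym (^-zeroˡ q))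
integerRoot q (suc X) with integerRoot q X
... | E , lo , hi with suc X <? suc E ^ q
...   | yes hi′ = E , m≤n⇒m≤1+n lo , hi′
...   | no  ¬hi = suc E , ≮⇒≥ ¬hi , ≤-<-trans hi (^-monoˡ-< q (n<1+n (suc E)))

m≤m^q : ∀ m q .{{_ : NonZero q}} → m ≤ m ^ q
m≤m^q zero       q        = z≤n
m≤m^q m@(suc _) (suc q) = m≤m*n m (m ^ q) {{m^n≢0 m q}}

-- The case ε = 1/q. As Δ = O(P⁶), the divisor bound with exponent 1/(6 q) gives O(P^(1/q))
-- divisors.
T₃-bound : ∀ q .{{_ : NonZero q}} → ∃[ C ] (∀ h → h ≢ (0ℤ , 0ℤ , 0ℤ) →
           ∀ P .{{_ : NonZero P}} → T₃ P h ^ q ≤ C ^ q * P ^ (2 * q + 1))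
T₃-bound q = C , bound
  where
  instance
    _ = m*n≢0 q 6
  K = proj₁ (divisorBound (q * 6))
  -- The successor makes L positive; hence E ≥ 1, and E absorbs the degenerate terms.
  L = suc (K * 2432)
  -- 100 = 8 + 92, with 8 E P² from the regular pairs and 92 = 9 · 8 + 9 · 2 + 2 from the 9 P
  -- degenerate pairs and the isolated one.
  C = 100 * L
  module _ (P : ℕ) .{{_ : NonZero P}} where
    -- A common bound for the divisor counts of all the Δ k that occur, as these are O(P⁶).
    E = proj₁ (integerRoot q (L * P))
    E^q≤ = proj₁ (proj₂ (integerRoot q (L * P)))
    <E^q = proj₂ (proj₂ (integerRoot q (L * P)))
    1≤E : 1 ≤ E
    1≤E with E | <E^q
    ... | suc _ | _ = s≤s z≤n
    ... | zero  | lt =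
      contradiction (≤-trans (m≤m*n L P) (≤-pred (≤-trans lt (≤-reflexive (^-zeroˡ q))))) λ ()
    K*n≤ : ∀ {n} → n ≤ 2432 * P ^ 6 → K * n ≤ (L * P) ^ 6
    K*n≤ {n} n≤ = begin
      K * n               ≤⟨ *-monoʳ-≤ K n≤ ⟩
      K * (2432 * P ^ 6)  ≡⟨ *-assoc K 2432 (P ^ 6) ⟨
      K * 2432 * P ^ 6    ≤⟨ *-monoˡ-≤ (P ^ 6) (≤-trans (n≤1+n _) (m≤m^q L 6)) ⟩
      L ^ 6 * P ^ 6       ≡⟨ ^-distribʳ-* 6 L P ⟨
      (L * P) ^ 6         ∎
      where open ≤-Reasoning
    rest-count : ∀ k → proj₁ k ≢ 0ℤ → Δ k ≢ 0ℤ → AtMost (E * 2 * 4) (Rest P k)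
    -- `inhabited` supplies the solution `r` from which `Δ-bound` is read off.
    rest-count k k₁≢0 Δ≢0 = inhabited λ r →
      let D , c , D^≤ = proj₂ (divisorBound (q * 6)) ∣ Δ k ∣ {{≢-nonZero (Δ≢0 ∘ ℤ.∣i∣≡0⇒i≡0)}}
          D^q≤ : D ^ q ≤ L * P
          D^q≤ = ^-cancelʳ-≤ 6 (≤-trans (≤-reflexive (^-*-assoc D q 6)) (≤-trans D^≤ (K*n≤ (Δ-bound r))))
          D≤E : D ≤ E
          D≤E = ≮⇒≥ (λ E<D → <⇒≱ <E^q (≤-trans (^-monoˡ-≤ q E<D) D^q≤))
      in relax (*-monoˡ-≤ 4 (*-monoˡ-≤ 2 D≤E)) (rest-divisor k k₁≢0 Δ≢0 c)
  bound : ∀ h → h ≢ (0ℤ , 0ℤ , 0ℤ) → ∀ P .{{_ : NonZero P}} → T₃ P h ^ q ≤ C ^ q * P ^ (2 * q + 1)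
  bound h h≢0 P = begin
    T₃ P h ^ q                              ≤⟨ ^-monoˡ-≤ q (T₃≤ h (full-count h h≢0 (rest-count P))) ⟩
    _                                       ≡⟨ cong (_^ q) (total P (E P)) ⟩
    (8 * E P * P² + 92 * P²) ^ q            ≤⟨ ^-monoˡ-≤ q (+-monoʳ-≤ (8 * E P * P²) (*-monoˡ-≤ P² 92≤92E)) ⟩
    (8 * E P * P² + 92 * E P * P²) ^ q      ≡⟨ cong (_^ q) (*-distribʳ-+ P² (8 * E P) (92 * E P)) ⟨
    ((8 * E P + 92 * E P) * P²) ^ q         ≡⟨ cong (λ z → (z * P²) ^ q) (*-distribʳ-+ (E P) 8 92) ⟨
    (100 * E P * P²) ^ q                    ≡⟨ ^-distribʳ-* q (100 * E P) P² ⟩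
    (100 * E P) ^ q * P² ^ q                ≡⟨ cong₂ _*_ (^-distribʳ-* q 100 (E P)) (^-*-assoc P 2 q) ⟩
    100 ^ q * E P ^ q * P ^ (2 * q)         ≤⟨ *-monoˡ-≤ (P ^ (2 * q)) (*-monoʳ-≤ (100 ^ q) (E^q≤ P)) ⟩
    100 ^ q * (L * P) * P ^ (2 * q)         ≡⟨ rearrange (100 ^ q) L P (P ^ (2 * q)) ⟩
    100 ^ q * L * (P ^ (2 * q) * (P * 1))   ≤⟨ *-monoˡ-≤ _ (*-monoʳ-≤ (100 ^ q) (m≤m^q L q)) ⟩
    100 ^ q * L ^ q * (P ^ (2 * q) * P ^ 1) ≡⟨ cong₂ _*_ (^-distribʳ-* q 100 L) (^-distribˡ-+-* P (2 * q) 1) ⟨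
    C ^ q * P ^ (2 * q + 1)                 ∎
    where
    open ≤-Reasoning
    P² = P ^ 2
    92≤92E : 92 ≤ 92 * E P
    92≤92E = m≤m*n 92 (E P) {{>-nonZero (1≤E P)}}
    total : ∀ P E → let N = P + (P + (P + (P + P) * 3)) in
      P * P * (E * 2 * 4) + (N * ((P + P) * 4) + (N * (P * 2) + 1 * (P * P * 2))) ≡
      8 * E * (P * (P * 1)) + 92 * (P * (P * 1))
    total = solve-∀
    rearrange : ∀ a b c d → a * (b * c) * d ≡ a * b * (d * (c * 1))
    rearrange = solve-∀

-- The q-th power of the claim follows from the b-th power of the hypothesis, since 1/q ≤ a/b.
rescale : ∀ q b {N C P a} .{{_ : NonZero q}} .{{_ : NonZero P}} → b ≤ a * q →
          N ^ q ≤ C ^ q * P ^ (2 * q + 1) → N ^ b ≤ C ^ b * P ^ (2 * b + a)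
rescale q b {N} {C} {P} {a} b≤aq le = ^-cancelʳ-≤ q (begin
  (N ^ b) ^ q                               ≡⟨ swap N b q ⟩
  (N ^ q) ^ b                               ≤⟨ ^-monoˡ-≤ b le ⟩
  (C ^ q * P ^ (2 * q + 1)) ^ b             ≡⟨ ^-distribʳ-* b (C ^ q) (P ^ (2 * q + 1)) ⟩
  (C ^ q) ^ b * (P ^ (2 * q + 1)) ^ b       ≡⟨ cong₂ _*_ (swap C q b) (^-*-assoc P (2 * q + 1) b) ⟩
  (C ^ b) ^ q * P ^ ((2 * q + 1) * b)       ≤⟨ *-monoʳ-≤ ((C ^ b) ^ q) (^-monoʳ-≤ P exponent) ⟩
  (C ^ b) ^ q * P ^ ((2 * b + a) * q)       ≡⟨ cong ((C ^ b) ^ q *_) (^-*-assoc P (2 * b + a) q) ⟨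
  (C ^ b) ^ q * (P ^ (2 * b + a)) ^ q       ≡⟨ ^-distribʳ-* q (C ^ b) (P ^ (2 * b + a)) ⟨
  (C ^ b * P ^ (2 * b + a)) ^ q             ∎)
  where
  open ≤-Reasoning
  swap : ∀ m i j → (m ^ i) ^ j ≡ (m ^ j) ^ i
  swap m i j = trans (^-*-assoc m i j) (trans (cong (m ^_) (*-comm i j)) (sym (^-*-assoc m j i)))
  expand : ∀ q b → (2 * q + 1) * b ≡ 2 * b * q + b
  expand = solve-∀
  exponent : (2 * q + 1) * b ≤ (2 * b + a) * q
  exponent = ≤-trans (≤-reflexive (expand q b))
    (≤-trans (+-monoʳ-≤ (2 * b * q) b≤aq) (≤-reflexive (sym (*-distribʳ-+ q (2 * b) a))))

-- Real ε.

lower<upper : ∀ (x : ℝ) {r s} → lower x r → upper x s → r ℚ.< s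
lower<upper x {r} {s} lr us with ℚ.<-cmp r s
... | tri< r<s _ _  = r<s
... | tri≈ _ refl _ = contradiction (lr , us) (disjoint x r)
... | tri> _ _ s<r  = contradiction (Equivalence.from (lower-rounded x s) (r , s<r , lr) , us) (disjoint x s)

-- q is the denominator of a positive rational below ε, so that 1 / q < ε.
positive-lower : ∀ ε → Positive ε →
  ∃[ q ] (NonZero q × ∀ a b .{{_ : NonZero b}} → upper ε ((+ a) ℚ./ b) → b ≤ a * q)
positive-lower ε ε>0 with Equivalence.to (lower-rounded ε 0ℚ) ε>0
... | mkℚ (+ zero)   _  _ , ℚ.*<* (ℤ.+<+ ()) , _
... | mkℚ -[1+ _ ]   _  _ , ℚ.*<* () , _
... | r@(mkℚ (+ suc p) d _) , _ , lr = suc d , _ , gap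
  where
  gap : ∀ a b .{{_ : NonZero b}} → upper ε ((+ a) ℚ./ b) → b ≤ a * suc d
  gap a b@(suc b′) ua with ℚᵘ.<-respʳ-≃ (ℚ.toℚᵘ-fromℚᵘ (ℚᵘ.mkℚᵘ (+ a) b′))
                                       (ℚ.toℚᵘ-mono-< (lower<upper ε {r} lr ua))
  -- Clearing denominators in (p + 1)/(d + 1) < a/b gives b ≤ (p + 1) b < a (d + 1).
  ... | ℚᵘ.*<* lt = ≤-trans (m≤n*m b (suc p))
    (<⇒≤ (ℤ.drop‿+<+ (subst₂ ℤ._<_ (sym (ℤ.pos-* (suc p) b)) (sym (ℤ.pos-* a (suc d))) lt)))

corollary1p4 : ∀ (ε : ℝ) → Positive ε →
    ∃[ C ] (∀ (h : ℤ × ℤ × ℤ) → h ≢ (0ℤ , 0ℤ , 0ℤ) →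
    ∀ (P : ℕ) .{{_ : NonZero P}} → T₃ P h ≤ C · P ^⟨ 2 + ε ⟩)
corollary1p4 ε ε>0 =
  let q , q≢0 , gap = positive-lower ε ε>0
      C , bound = T₃-bound q {{q≢0}}
  in C , λ h h≢0 P a b ua → rescale q b {{q≢0}} (gap a b ua) (bound h h≢0 P)
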